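{- Let $a$ and $b$ be positive integers such that $2\le a<b$ and $a$ does not divide $b$. Then the diagonal binary $\mathbb Z$-lattice $\ell=\langle a,b\rangle$ is not recoverable.
   Context: A $\mathbb Z$-lattice is a free $\mathbb Z$-module $L$ of finite rank with a positive definite symmetric bilinear form $B:L\times L\to\mathbb Z$ (integral valued). $\langle a_1,\dots,a_k\rangle$ denotes the $\mathbb Z$-lattice with an orthogonal basis $x_1,\dots,x_k$ satisfying $B(x_i,x_i)=a_i$. A $\mathbb Z$-lattice $\ell$ is represented by $L$ if there is a $\mathbb Z$-linear map $\sigma:\ell\to L$ with $B(\sigma x,\sigma y)=B(x,y)$ for all $x,y\in\ell$. A $\mathbb Z$-lattice $\ell$ is recoverable if there is a finite set $\{\ell_1,\dots,\ell_t\}$ of proper sublattices of $\ell$ such that every $\mathbb Z$-lattice (of any rank) that represents all of $\ell_1,\dots,\ell_t$ also represents $\ell$. -}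

module Defs where

open import Algebra.Construct.Pointwise using () renaming (isAbelianGroup to pointwise-isAbelianGroup)
open import Algebra.Bundles using (AbelianGroup)
open import Algebra.Definitions.RawMonoid using (sum)
open import Algebra.Module.Bundles using (LeftModule)
open import Algebra.Module.Bundles.Raw using (RawLeftModule)
open import Algebra.Module.Morphism.LeftModuleMonomorphism using ()
  renaming (isLeftModule to pullback-isLeftModule)
open import Algebra.Module.Morphism.Structures using (module LeftModuleMorphisms)
open import Algebra.Properties.Semiring.Sum using (∑-distrib-+; *-distribˡ-sum; sum-cong-≗; sum-replicate-zero)
open import Data.Bool.Base using (if_then_else_)
open import Data.Fin.Base using (Fin; zero; suc)
open import Data.Fin.Properties using (_≟_; ¬∀⟶∃¬)
open import Data.Integer.Base using (ℤ; +_; -[1+_]; 0ℤ; 1ℤ; _+_; _*_; _<_; _≤_; +≤+; +<+)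
import Data.Integer.Properties as ℤ
open import Data.Integer.Solver using (module +-*-Solver)
open import Data.Nat.Base as ℕ using (ℕ; zero; suc)
open import Data.Product.Base using (Σ; ∃; _×_; _,_; proj₁; proj₂; Σ-syntax)
open import Data.Vec.Functional using (Vector; []; _∷_)
open import Function.Base using (_∘_)
open import Level using (0ℓ)
open import Relation.Binary.Definitions using (_Respects_)
open import Relation.Binary.PropositionalEquality
  using (_≡_; _≢_; _≗_; refl; sym; trans; cong; cong₂; subst; module ≡-Reasoning)
open import Relation.Nullary using (¬_; does; contradiction)
open import Relation.Unary using (Pred)

-- ℤ is commutative, so left modules suffice.
ℤ-Module : Set₁
ℤ-Module = LeftModule ℤ.+-*-ring 0ℓ 0ℓ

module _ (M : ℤ-Module) where
  open LeftModule M

  linearCombination : ∀ {n} → Vector ℤ n → Vector Carrierᴹ n → Carrierᴹ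
  linearCombination c v = sum +ᴹ-rawMonoid (λ i → c i *ₗ v i)

  record IsBasis {n : ℕ} (v : Vector Carrierᴹ n) : Set where
    field
      independent : ∀ c → linearCombination c v ≈ᴹ 0ᴹ → ∀ i → c i ≡ 0ℤ
      spanning    : ∀ x → ∃ λ c → x ≈ᴹ linearCombination c v

  IsFreeOfRank : ℕ → Set
  IsFreeOfRank n = Σ[ v ∈ Vector Carrierᴹ n ] IsBasis v

  record IsPositiveDefiniteForm (B : Carrierᴹ → Carrierᴹ → ℤ) : Set where
    field
      B-cong    : ∀ {x x′ y y′} → x ≈ᴹ x′ → y ≈ᴹ y′ → B x y ≡ B x′ y′
      B-sym     : ∀ x y → B x y ≡ B y x
      -- Linearity in the second argument follows by symmetry.
      B-+ᴹ      : ∀ x y z → B (x +ᴹ y) z ≡ B x z + B y z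
      B-*ₗ      : ∀ k x y → B (k *ₗ x) y ≡ k * B x y
      B-pos     : ∀ x → ¬ (x ≈ᴹ 0ᴹ) → 0ℤ < B x x

record ℤ-Lattice : Set₁ where
  field
    ℤ-module : ℤ-Module

  open LeftModule ℤ-module public

  field
    rank   : ℕ
    isFree : IsFreeOfRank ℤ-module rank
    B      : Carrierᴹ → Carrierᴹ → ℤ
    isPositiveDefiniteForm : IsPositiveDefiniteForm ℤ-module B

  open IsPositiveDefiniteForm isPositiveDefiniteForm public

record _represents_ (L ℓ : ℤ-Lattice) : Set where
  private
    module L = ℤ-Lattice L
    module ℓ = ℤ-Lattice ℓ
  open LeftModuleMorphisms ℓ.rawLeftModule L.rawLeftModule using (IsLeftModuleHomomorphism)

  field
    σ        : ℓ.Carrierᴹ → L.Carrierᴹ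
    isLinear : IsLeftModuleHomomorphism σ
    isometry : ∀ x y → L.B (σ x) (σ y) ≡ ℓ.B x y

module _ (M : ℤ-Module) where
  open LeftModule M

  record IsSubmodule (P : Pred Carrierᴹ 0ℓ) : Set where
    field
      resp      : P Respects _≈ᴹ_
      0ᴹ-closed : P 0ᴹ
      +ᴹ-closed : ∀ {x y} → P x → P y → P (x +ᴹ y)
      -ᴹ-closed : ∀ {x} → P x → P (-ᴹ x)
      *ₗ-closed : ∀ k {x} → P x → P (k *ₗ x)

  module _ {P : Pred Carrierᴹ 0ℓ} (isSubmodule : IsSubmodule P) where
    open IsSubmodule isSubmodule

    rawSubmodule : RawLeftModule ℤ 0ℓ 0ℓ
    rawSubmodule = record
      { Carrierᴹ = Σ Carrierᴹ P
      ; _≈ᴹ_     = λ x y → proj₁ x ≈ᴹ proj₁ y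
      ; _+ᴹ_     = λ x y → proj₁ x +ᴹ proj₁ y , +ᴹ-closed (proj₂ x) (proj₂ y)
      ; _*ₗ_     = λ k x → k *ₗ proj₁ x , *ₗ-closed k (proj₂ x)
      ; 0ᴹ       = 0ᴹ , 0ᴹ-closed
      ; -ᴹ_      = λ x → -ᴹ proj₁ x , -ᴹ-closed (proj₂ x)
      }

    open LeftModuleMorphisms rawSubmodule rawLeftModule using (IsLeftModuleMonomorphism)

    inclusion-isMonomorphism : IsLeftModuleMonomorphism proj₁
    inclusion-isMonomorphism = record
      { isLeftModuleHomomorphism = record
        { +ᴹ-isGroupHomomorphism = record
          { isMonoidHomomorphism = record
            { isMagmaHomomorphism = record
              { isRelHomomorphism = record { cong = λ x≈y → x≈y }
              ; homo = λ _ _ → ≈ᴹ-refl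
              }
            ; ε-homo = ≈ᴹ-refl
            }
          ; ⁻¹-homo = λ _ → ≈ᴹ-refl
          }
        ; *ₗ-homo = λ _ _ → ≈ᴹ-refl
        }
      ; injective = λ x≈y → x≈y
      }

    submodule : ℤ-Module
    submodule = record
      { isLeftModule = pullback-isLeftModule inclusion-isMonomorphism ℤ.+-*-isRing isLeftModule
      }

-- A submodule of L which is itself a lattice under the restriction of B.
-- Classically every submodule is free; constructively a basis is data.
record Sublattice (L : ℤ-Lattice) : Set₁ where
  open ℤ-Lattice L using (ℤ-module; Carrierᴹ)
  field
    mem         : Pred Carrierᴹ 0ℓ
    isSubmodule : IsSubmodule ℤ-module mem
    rank        : ℕ
    isFree      : IsFreeOfRank (submodule ℤ-module isSubmodule) rank

  Proper : Set
  Proper = ¬ (∀ x → mem x)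

  lattice : ℤ-Lattice
  lattice = record
    { ℤ-module = submodule ℤ-module isSubmodule
    ; rank     = rank
    ; isFree   = isFree
    ; B        = λ x y → B (proj₁ x) (proj₁ y)
    ; isPositiveDefiniteForm = record
      { B-cong = B-cong
      ; B-sym  = λ x y → B-sym (proj₁ x) (proj₁ y)
      ; B-+ᴹ   = λ x y z → B-+ᴹ (proj₁ x) (proj₁ y) (proj₁ z)
      ; B-*ₗ   = λ k x y → B-*ₗ k (proj₁ x) (proj₁ y)
      ; B-pos  = λ x → B-pos (proj₁ x)
      }
    }
    where open ℤ-Lattice L using (B; B-cong; B-sym; B-+ᴹ; B-*ₗ; B-pos)

-- The finite set of sublattices is given as a family; repetitions are harmless.
Recoverable : ℤ-Lattice → Set₁
Recoverable ℓ =
  ∃ λ (t : ℕ) → Σ[ ℓs ∈ Vector (Sublattice ℓ) t ]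
    (∀ i → Sublattice.Proper (ℓs i)) ×
    (∀ (L : ℤ-Lattice) → (∀ i → L represents Sublattice.lattice (ℓs i)) → L represents ℓ)

∑ : ∀ {n} → Vector ℤ n → ℤ
∑ = sum (AbelianGroup.rawMonoid ℤ.+-0-abelianGroup)

infixr 8 ℤ^_
ℤ^_ : ℕ → ℤ-Module
ℤ^ k = record
  { _≈ᴹ_ = _≗_
  ; _+ᴹ_ = λ x y i → x i + y i
  ; _*ₗ_ = λ c x i → c * x i
  ; isLeftModule = record
    { isLeftSemimodule = record
      { +ᴹ-isCommutativeMonoid = ℤ^k.isCommutativeMonoid
      ; isPreleftSemimodule = record
        { *ₗ-cong      = λ c≡d x≗y i → cong₂ _*_ c≡d (x≗y i)
        ; *ₗ-zeroˡ     = λ x i → ℤ.*-zeroˡ (x i)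
        ; *ₗ-distribʳ  = λ x c d i → ℤ.*-distribʳ-+ (x i) c d
        ; *ₗ-identityˡ = λ x i → ℤ.*-identityˡ (x i)
        ; *ₗ-assoc     = λ c d x i → ℤ.*-assoc c d (x i)
        ; *ₗ-zeroʳ     = λ c i → ℤ.*-zeroʳ c
        ; *ₗ-distribˡ  = λ c x y i → ℤ.*-distribˡ-+ c (x i) (y i)
        }
      }
    ; -ᴹ‿cong    = ℤ^k.⁻¹-cong
    ; -ᴹ‿inverse = ℤ^k.inverse
    }
  }
  where
  ℤ^k-abelianGroup : AbelianGroup 0ℓ 0ℓ
  ℤ^k-abelianGroup = record
    { isAbelianGroup = pointwise-isAbelianGroup (Fin k) ℤ.+-0-isAbelianGroup }
  module ℤ^k = AbelianGroup ℤ^k-abelianGroup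

standardBasis : ∀ {k} → Vector (Vector ℤ k) k
standardBasis i j = if does (i ≟ j) then 1ℤ else 0ℤ

∑-*-standardBasis : ∀ {k} (c : Vector ℤ k) j → ∑ (λ i → c i * standardBasis i j) ≡ c j
∑-*-standardBasis {suc k} c zero = begin
  c zero * 1ℤ + ∑ (λ i → c (suc i) * 0ℤ)
    ≡⟨ cong₂ _+_ (ℤ.*-identityʳ (c zero))
         (sum-cong-≗ ℤ.+-*-semiring {k} (λ i → ℤ.*-zeroʳ (c (suc i)))) ⟩
  c zero + ∑ {k} (λ _ → 0ℤ)
    ≡⟨ cong (_+_ (c zero)) (sum-replicate-zero ℤ.+-*-semiring k) ⟩
  c zero + 0ℤ
    ≡⟨ ℤ.+-identityʳ (c zero) ⟩
  c zero ∎
  where open ≡-Reasoning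
∑-*-standardBasis {suc k} c (suc j) =
  trans (cong₂ _+_ (ℤ.*-zeroʳ (c zero)) (∑-*-standardBasis (c ∘ suc) j))
        (ℤ.+-identityˡ (c (suc j)))

linearCombination-ℤ^ : ∀ {k n} (c : Vector ℤ n) (v : Vector (Vector ℤ k) n) j →
                       linearCombination (ℤ^ k) c v j ≡ ∑ (λ i → c i * v i j)
linearCombination-ℤ^ {n = zero}  c v j = refl
linearCombination-ℤ^ {n = suc n} c v j =
  cong (_+_ (c zero * v zero j)) (linearCombination-ℤ^ (c ∘ suc) (v ∘ suc) j)

standardBasis-isBasis : ∀ {k} → IsBasis (ℤ^ k) standardBasis
standardBasis-isBasis {k} = record
  { independent = λ c eq i → trans (sym (combination c i)) (eq i)
  ; spanning    = λ x → x , λ i → sym (combination x i)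
  }
  where
  combination : ∀ c j → linearCombination (ℤ^ k) c standardBasis j ≡ c j
  combination c j = trans (linearCombination-ℤ^ c standardBasis j) (∑-*-standardBasis c j)

diagonalForm : ∀ {k} → Vector ℕ k → Vector ℤ k → Vector ℤ k → ℤ
diagonalForm a x y = ∑ (λ i → + a i * (x i * y i))

0≤square : ∀ i → 0ℤ ≤ i * i
0≤square (+ n)     = subst (0ℤ ≤_) (ℤ.pos-* n n) (+≤+ ℕ.z≤n)
0≤square (-[1+ n ]) = +≤+ ℕ.z≤n

0<square : ∀ {i} → i ≢ 0ℤ → 0ℤ < i * i
0<square {+ zero}    i≢0 = contradiction refl i≢0
0<square {+ suc n}   i≢0 = +<+ ℕ.z<s
0<square { -[1+ n ]} i≢0 = +<+ ℕ.z<s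

0≤∑ : ∀ {n} (t : Vector ℤ n) → (∀ i → 0ℤ ≤ t i) → 0ℤ ≤ ∑ t
0≤∑ {zero}  t 0≤t = +≤+ ℕ.z≤n
0≤∑ {suc n} t 0≤t = ℤ.+-mono-≤ (0≤t zero) (0≤∑ (t ∘ suc) (0≤t ∘ suc))

0<∑ : ∀ {n} (t : Vector ℤ n) → (∀ i → 0ℤ ≤ t i) → ∀ j → 0ℤ < t j → 0ℤ < ∑ t
0<∑ t 0≤t zero    0<tj = ℤ.+-mono-<-≤ 0<tj (0≤∑ (t ∘ suc) (0≤t ∘ suc))
0<∑ t 0≤t (suc j) 0<tj = ℤ.+-mono-≤-< (0≤t zero) (0<∑ (t ∘ suc) (0≤t ∘ suc) j 0<tj)

diagonalForm-isPositiveDefinite : ∀ {k} (a : Vector ℕ k) → (∀ i → 0 ℕ.< a i) →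
                                  IsPositiveDefiniteForm (ℤ^ k) (diagonalForm a)
diagonalForm-isPositiveDefinite {k} a 0<a = record
  { B-cong = λ x≗x′ y≗y′ → ∑-cong (λ i → cong (+ a i *_) (cong₂ _*_ (x≗x′ i) (y≗y′ i)))
  ; B-sym  = λ x y → ∑-cong (λ i → cong (+ a i *_) (ℤ.*-comm (x i) (y i)))
  ; B-+ᴹ   = λ x y z → trans
      (∑-cong (λ i → distrib (+ a i) (x i) (y i) (z i)))
      (∑-distrib-+ ℤ.+-*-semiring (λ i → + a i * (x i * z i)) (λ i → + a i * (y i * z i)))
  ; B-*ₗ   = λ c x y → trans
      (∑-cong (λ i → pull (+ a i) c (x i) (y i)))
      (sym (*-distribˡ-sum ℤ.+-*-semiring c (λ i → + a i * (x i * y i))))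
  ; B-pos  = pos
  }
  where
  open +-*-Solver

  ∑-cong : ∀ {s t : Vector ℤ k} → s ≗ t → ∑ s ≡ ∑ t
  ∑-cong = sum-cong-≗ ℤ.+-*-semiring

  distrib : ∀ d x y z → d * ((x + y) * z) ≡ d * (x * z) + d * (y * z)
  distrib = solve 4 (λ d x y z → d :* ((x :+ y) :* z) := d :* (x :* z) :+ d :* (y :* z)) refl

  pull : ∀ d c x y → d * ((c * x) * y) ≡ c * (d * (x * y))
  pull = solve 4 (λ d c x y → d :* ((c :* x) :* y) := c :* (d :* (x :* y))) refl

  0≤* : ∀ n {i} → 0ℤ ≤ i → 0ℤ ≤ + n * i
  0≤* n {i} 0≤i = subst (_≤ + n * i) (ℤ.*-zeroʳ (+ n)) (ℤ.*-monoˡ-≤-nonNeg (+ n) 0≤i)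

  0<* : ∀ {n i} → 0 ℕ.< n → 0ℤ < i → 0ℤ < + n * i
  0<* {suc n} {i} _ 0<i =
    subst (_< + suc n * i) (ℤ.*-zeroʳ (+ suc n)) (ℤ.*-monoˡ-<-pos (+ suc n) 0<i)

  pos : ∀ x → ¬ (x ≗ λ _ → 0ℤ) → 0ℤ < diagonalForm a x x
  pos x x≢0 with ¬∀⟶∃¬ k _ (λ i → x i ℤ.≟ 0ℤ) x≢0
  ... | j , xj≢0 = 0<∑ _ (λ i → 0≤* (a i) (0≤square (x i))) j (0<* (0<a j) (0<square xj≢0))

diagonalLattice : ∀ {k} (a : Vector ℕ k) → (∀ i → 0 ℕ.< a i) → ℤ-Lattice
diagonalLattice {k} a 0<a = record
  { ℤ-module = ℤ^ k
  ; rank     = k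
  ; isFree   = standardBasis , standardBasis-isBasis
  ; B        = diagonalForm a
  ; isPositiveDefiniteForm = diagonalForm-isPositiveDefinite a 0<a
  }

⟨_,_⟩ : (a b : ℕ) → 0 ℕ.< a → 0 ℕ.< b → ℤ-Lattice
⟨ a , b ⟩ 0<a 0<b = diagonalLattice (a ∷ b ∷ []) 0<entries
  where
  0<entries : ∀ i → 0 ℕ.< (a ∷ b ∷ []) i
  0<entries zero       = 0<a
  0<entries (suc zero) = 0<b

{-# OPTIONS --safe #-}
module Submission where

-- Every proper sublattice P of ⟨ a , b ⟩ lies in one of the following sublattices of ℤ², with g, d ≥ 2:
-- ℤ ⊕ gℤ, where g generates the second coordinates of P; or, when P contains some (s , 1), the set of
-- (x , y) with d ∣ x − s y, which is dℤ ⊕ ℤ if d ∣ s and contains neither (1 , 0) nor (0 , 1) otherwise.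
-- Let N have Gram matrix (a 1 ; 1 b), and let L be the orthogonal sum of N and of a "block" for each P: a
-- finite-index sublattice of ⟨ a , b ⟩ containing neither basis vector.  N supplies ⟨a⟩ to represent
-- ℤ ⊕ gℤ, supplies ⟨b⟩ to represent dℤ ⊕ ℤ, and is not needed in the last case; so L represents every P.
-- A sum of blocks has no vector of norm a or b, since its norms are a s + b t with (s , t) ≠ (1 , 0), (0 , 1).
-- Hence the vectors of norm a in L are the two minimal vectors of N (here a ≥ 2 and a < b are used), and a
-- vector of norm b orthogonal to one of them has no component in N, so it would lie in the sum of blocks.

open import Defs
open import Algebra.Module.Bundles using (LeftModule)
open import Algebra.Properties.AbelianGroup using (inverseˡ-unique; inverseʳ-unique)
open import Data.Empty using (⊥)
open import Data.Fin.Base using (Fin; zero; suc; splitAt; _↑ˡ_; _↑ʳ_)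
open import Data.Fin.Properties using (all?; splitAt⁻¹-↑ˡ; splitAt⁻¹-↑ʳ)
open import Data.Integer.Base as ℤ using (ℤ; +_; 0ℤ; 1ℤ; _+_; _*_; -_; ∣_∣)
open import Data.Integer.Divisibility.Signed
  using (_∣_; divides; _∣?_; ∣ᵤ⇒∣; ∣⇒∣ᵤ; ∣m∣n⇒∣m+n; ∣n⇒∣m*n; ∣-trans; ∣-refl; 0∣⇒≡0)
import Data.Integer.Properties as ℤ
open import Data.Integer.Tactic.RingSolver using (solve-∀)
open import Data.Nat.Base as ℕ using (ℕ; _≤_; _<_; zero; suc)
import Data.Nat.Divisibility as ℕ
open import Data.Nat.Divisibility using (_∤_)
open import Data.Nat.GCD using (module GCD; module Bézout)
import Data.Nat.Properties as ℕ
import Data.Nat.Tactic.RingSolver as ℕSolver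
open import Data.Product.Base using (∃; ∃₂; _×_; _,_; proj₁; proj₂; swap)
open import Data.Sum.Base using (inj₁; inj₂)
open import Data.Vec.Functional using (Vector; []; _∷_; _++_; take; drop)
open import Data.Vec.Functional.Properties using (lookup-++ˡ; lookup-++ʳ)
open import Function.Base using (_∘_)
open import Relation.Binary.PropositionalEquality
  using (_≡_; _≢_; _≗_; refl; sym; trans; cong; cong₂; subst; subst₂; module ≡-Reasoning)
open import Relation.Nullary using (¬_; Dec; yes; no; contradiction)

interchange : ∀ s t u v → (s + t) + (u + v) ≡ (s + u) + (t + v)
interchange = solve-∀

-- Positive definite forms on ℤ^k and maps that preserve them.

Form : ℕ → Set
Form k = Vector ℤ k → Vector ℤ k → ℤ

module PositiveDefinite {M : ℤ-Module} {B} (pd : IsPositiveDefiniteForm M B) where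
  open LeftModule M
  open IsPositiveDefiniteForm pd

  B-+ᴹʳ : ∀ x y z → B x (y +ᴹ z) ≡ B x y + B x z
  B-+ᴹʳ x y z = trans (B-sym x (y +ᴹ z))
    (trans (B-+ᴹ y z x) (cong₂ _+_ (B-sym y x) (B-sym z x)))

  B-*ₗʳ : ∀ k x y → B x (k *ₗ y) ≡ k * B x y
  B-*ₗʳ k x y = trans (B-sym x (k *ₗ y)) (trans (B-*ₗ k y x) (cong (k *_) (B-sym y x)))

  B-0ᴹˡ : ∀ x → B 0ᴹ x ≡ 0ℤ
  B-0ᴹˡ x = trans (B-cong (≈ᴹ-sym (*ₗ-zeroˡ x)) ≈ᴹ-refl) (B-*ₗ 0ℤ x x)

  B--ᴹˡ : ∀ x y → B (-ᴹ x) y ≡ - B x y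
  B--ᴹˡ x y = inverseˡ-unique ℤ.+-0-abelianGroup (B (-ᴹ x) y) (B x y)
    (trans (sym (B-+ᴹ (-ᴹ x) x y)) (trans (B-cong (-ᴹ‿inverseˡ x) ≈ᴹ-refl) (B-0ᴹˡ y)))

  B--ᴹʳ : ∀ x y → B x (-ᴹ y) ≡ - B x y
  B--ᴹʳ x y = trans (B-sym x (-ᴹ y)) (trans (B--ᴹˡ y x) (cong -_ (B-sym y x)))

module PositiveDefiniteℤ^ {k} {B : Form k} (pd : IsPositiveDefiniteForm (ℤ^ k) B) where
  open LeftModule (ℤ^ k)
  open IsPositiveDefiniteForm pd
  open PositiveDefinite pd public

  -- `B-pos` refutes the negation of `x ≗ 0` only; deciding the finitely many coordinates turns this
  -- into pointwise vanishing.
  anisotropic : ∀ x → B x x ≡ 0ℤ → x ≗ λ _ → 0ℤ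
  anisotropic x Bxx≡0 with all? (λ i → x i ℤ.≟ 0ℤ)
  ... | yes x≗0 = x≗0
  ... | no  x≢0 = contradiction (B-pos x x≢0) (ℤ.<-irrefl (sym Bxx≡0))

  norm-nonNegative : ∀ x → 0ℤ ℤ.≤ B x x
  norm-nonNegative x with all? (λ i → x i ℤ.≟ 0ℤ)
  ... | yes x≗0 = ℤ.≤-reflexive (sym (trans (B-cong x≗0 x≗0) (B-0ᴹˡ _)))
  ... | no  x≢0 = ℤ.<⇒≤ (B-pos x x≢0)

  -- Expanding by bilinearity, the norm of `u - v` is `(B u u - B u v) - (B v u - B v v)`. Both
  -- brackets vanish, so anisotropy applies.
  equal-products⇒≗ : ∀ u v → B u u ≡ B u v → B v v ≡ B v u → u ≗ v
  equal-products⇒≗ u v uu≡uv vv≡vu i = begin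
    u i                ≡⟨ split (u i) (v i) ⟩
    u i + - v i + v i  ≡⟨ cong (_+ v i) (anisotropic (u +ᴹ -ᴹ v) d²≡0 i) ⟩
    0ℤ + v i           ≡⟨ ℤ.+-identityˡ (v i) ⟩
    v i                ∎
    where
    open ≡-Reasoning
    split : ∀ s t → s ≡ s + - t + t
    split = solve-∀
    cancel : ∀ s t → s + - s + - (t + - t) ≡ 0ℤ
    cancel = solve-∀
    against : ∀ w → B w (u +ᴹ -ᴹ v) ≡ B w u + - B w v
    against w = trans (B-+ᴹʳ w u (-ᴹ v)) (cong (_+_ (B w u)) (B--ᴹʳ w v))
    d²≡0 : B (u +ᴹ -ᴹ v) (u +ᴹ -ᴹ v) ≡ 0ℤ
    d²≡0 = begin
      B (u +ᴹ -ᴹ v) (u +ᴹ -ᴹ v)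
        ≡⟨ B-+ᴹ u (-ᴹ v) _ ⟩
      B u (u +ᴹ -ᴹ v) + B (-ᴹ v) (u +ᴹ -ᴹ v)
        ≡⟨ cong (_+_ (B u (u +ᴹ -ᴹ v))) (B--ᴹˡ v _) ⟩
      B u (u +ᴹ -ᴹ v) + - B v (u +ᴹ -ᴹ v)
        ≡⟨ cong₂ (λ s t → s + - t) (against u) (against v) ⟩
      (B u u + - B u v) + - (B v u + - B v v)
        ≡⟨ cong₂ (λ s t → (B u u + - s) + - (B v u + - t)) (sym uu≡uv) vv≡vu ⟩
      (B u u + - B u u) + - (B v u + - B v u)
        ≡⟨ cancel (B u u) (B v u) ⟩
      0ℤ ∎

formLattice : ∀ {k} {B : Form k} → IsPositiveDefiniteForm (ℤ^ k) B → ℤ-Lattice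
formLattice {k} {B} pd = record
  { ℤ-module = ℤ^ k
  ; rank     = k
  ; isFree   = standardBasis , standardBasis-isBasis
  ; B        = B
  ; isPositiveDefiniteForm = pd
  }

-- A map preserving inner products is automatically linear: σ (x + y) and σ x + σ y have the same
-- products with every σ w, hence with each other, so their difference has norm 0.
isometry⇒represents : ∀ {k} {B : Form k} (pd : IsPositiveDefiniteForm (ℤ^ k) B) (ℓ : ℤ-Lattice) →
  (σ : ℤ-Lattice.Carrierᴹ ℓ → Vector ℤ k) →
  (∀ x y → B (σ x) (σ y) ≡ ℤ-Lattice.B ℓ x y) → formLattice pd represents ℓ
isometry⇒represents {k} {B} pd ℓ σ isometry = record
  { σ        = σ
  ; isLinear = record
    { +ᴹ-isGroupHomomorphism = record
      { isMonoidHomomorphism = record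
        { isMagmaHomomorphism = record
          { isRelHomomorphism = record { cong = σ-cong }
          ; homo = σ-+ᴹ
          }
        ; ε-homo = σ-0ᴹ
        }
      ; ⁻¹-homo = σ--ᴹ
      }
    ; *ₗ-homo = σ-*ₗ
    }
  ; isometry = isometry
  }
  where
  module ℓ = ℤ-Lattice ℓ
  module ℓᴮ = PositiveDefinite ℓ.isPositiveDefiniteForm
  open LeftModule (ℤ^ k)
  open IsPositiveDefiniteForm pd
  open PositiveDefiniteℤ^ pd

  σ-cong : ∀ {x y} → x ℓ.≈ᴹ y → σ x ≗ σ y
  σ-cong {x} {y} x≈y = equal-products⇒≗ (σ x) (σ y) (agree x) (sym (agree y))
    where
    agree : ∀ w → B (σ w) (σ x) ≡ B (σ w) (σ y)
    agree w = trans (isometry w x) (trans (ℓ.B-cong ℓ.≈ᴹ-refl x≈y) (sym (isometry w y)))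

  σ-+ᴹ : ∀ x y → σ (x ℓ.+ᴹ y) ≗ σ x +ᴹ σ y
  σ-+ᴹ x y = equal-products⇒≗ (σ (x ℓ.+ᴹ y)) (σ x +ᴹ σ y) (agree _)
    (trans (B-+ᴹ (σ x) (σ y) _)
      (trans (cong₂ _+_ (sym (agree x)) (sym (agree y))) (sym (B-+ᴹ (σ x) (σ y) _))))
    where
    agree : ∀ w → B (σ w) (σ (x ℓ.+ᴹ y)) ≡ B (σ w) (σ x +ᴹ σ y)
    agree w = trans (isometry w _) (trans (ℓᴮ.B-+ᴹʳ w x y)
      (trans (sym (cong₂ _+_ (isometry w x) (isometry w y))) (sym (B-+ᴹʳ (σ w) (σ x) (σ y)))))

  σ-0ᴹ : σ ℓ.0ᴹ ≗ 0ᴹ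
  σ-0ᴹ = anisotropic (σ ℓ.0ᴹ) (trans (isometry _ _) (ℓᴮ.B-0ᴹˡ ℓ.0ᴹ))

  σ-*ₗ : ∀ c x → σ (c ℓ.*ₗ x) ≗ c *ₗ σ x
  σ-*ₗ c x = equal-products⇒≗ (σ (c ℓ.*ₗ x)) (c *ₗ σ x) (agree _)
    (trans (B-*ₗ c (σ x) _) (trans (cong (c *_) (sym (agree x))) (sym (B-*ₗ c (σ x) _))))
    where
    agree : ∀ w → B (σ w) (σ (c ℓ.*ₗ x)) ≡ B (σ w) (c *ₗ σ x)
    agree w = trans (isometry w _) (trans (ℓᴮ.B-*ₗʳ c w x)
      (trans (sym (cong (c *_) (isometry w x))) (sym (B-*ₗʳ c (σ w) (σ x)))))

  σ--ᴹ : ∀ x → σ (ℓ.-ᴹ x) ≗ -ᴹ σ x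
  σ--ᴹ x = equal-products⇒≗ (σ (ℓ.-ᴹ x)) (-ᴹ σ x) (agree _)
    (trans (B--ᴹˡ (σ x) _) (trans (cong -_ (sym (agree x))) (sym (B--ᴹˡ (σ x) _))))
    where
    agree : ∀ w → B (σ w) (σ (ℓ.-ᴹ x)) ≡ B (σ w) (-ᴹ σ x)
    agree w = trans (isometry w _) (trans (ℓᴮ.B--ᴹʳ w x)
      (trans (sym (cong -_ (isometry w x))) (sym (B--ᴹʳ (σ w) (σ x)))))

-- Orthogonal sums and pullbacks of forms.

infixr 6 _⟂_
_⟂_ : ∀ {m n} → Form m → Form n → Form (m ℕ.+ n)
_⟂_ {m} B B′ x y = B (take m x) (take m y) + B′ (drop m x) (drop m y)

⟂-isPositiveDefinite : ∀ {m n} {B : Form m} {B′ : Form n} →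
  IsPositiveDefiniteForm (ℤ^ m) B → IsPositiveDefiniteForm (ℤ^ n) B′ →
  IsPositiveDefiniteForm (ℤ^ (m ℕ.+ n)) (B ⟂ B′)
⟂-isPositiveDefinite {m} {n} {B} {B′} pd pd′ = record
  { B-cong = λ x≗x′ y≗y′ → cong₂ _+_ (P.B-cong (x≗x′ ∘ (_↑ˡ n)) (y≗y′ ∘ (_↑ˡ n)))
                                     (P′.B-cong (x≗x′ ∘ (m ↑ʳ_)) (y≗y′ ∘ (m ↑ʳ_)))
  ; B-sym  = λ x y → cong₂ _+_ (P.B-sym _ _) (P′.B-sym _ _)
  ; B-+ᴹ   = λ x y z → trans
      (cong₂ _+_ (P.B-+ᴹ (take m x) (take m y) (take m z)) (P′.B-+ᴹ (drop m x) (drop m y) (drop m z)))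
      (interchange (B (take m x) (take m z)) _ _ _)
  ; B-*ₗ   = λ k x y → trans
      (cong₂ _+_ (P.B-*ₗ k (take m x) (take m y)) (P′.B-*ₗ k (drop m x) (drop m y)))
      (sym (ℤ.*-distribˡ-+ k (B (take m x) (take m y)) _))
  ; B-pos  = pos
  }
  where
  module P = IsPositiveDefiniteForm pd
  module P′ = IsPositiveDefiniteForm pd′

  pos : ∀ x → ¬ (x ≗ λ _ → 0ℤ) → 0ℤ ℤ.< (B ⟂ B′) x x
  -- Deciding whether the left half vanishes locates a nonzero half; its norm is positive and the
  -- other half adds a nonnegative norm.
  pos x x≢0 with all? (λ i → take m x i ℤ.≟ 0ℤ)
  ... | no  l≢0 = ℤ.+-mono-<-≤ (P.B-pos (take m x) l≢0)
                    (PositiveDefiniteℤ^.norm-nonNegative pd′ (drop m x))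
  ... | yes l≗0 = ℤ.+-mono-≤-< (PositiveDefiniteℤ^.norm-nonNegative pd (take m x))
                    (P′.B-pos (drop m x) (λ r≗0 → x≢0 (join r≗0)))
    where
    join : drop m x ≗ (λ _ → 0ℤ) → x ≗ λ _ → 0ℤ
    join r≗0 i with splitAt m i in eq
    ... | inj₁ j = trans (cong x (sym (splitAt⁻¹-↑ˡ eq))) (l≗0 j)
    ... | inj₂ j = trans (cong x (sym (splitAt⁻¹-↑ʳ eq))) (r≗0 j)

⟂-++ : ∀ {m n} {B : Form m} {B′ : Form n} →
  IsPositiveDefiniteForm (ℤ^ m) B → IsPositiveDefiniteForm (ℤ^ n) B′ →
  ∀ x x′ y y′ → (B ⟂ B′) (x ++ x′) (y ++ y′) ≡ B x y + B′ x′ y′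
⟂-++ pd pd′ x x′ y y′ = cong₂ _+_
  (IsPositiveDefiniteForm.B-cong pd (lookup-++ˡ x x′) (lookup-++ˡ y y′))
  (IsPositiveDefiniteForm.B-cong pd′ (lookup-++ʳ x x′) (lookup-++ʳ y y′))

module _ {m n} {B : Form n} (pd : IsPositiveDefiniteForm (ℤ^ n) B) (φ : Vector ℤ m → Vector ℤ n) where
  private
    module S = LeftModule (ℤ^ m)
    module T = LeftModule (ℤ^ n)
  open IsPositiveDefiniteForm pd

  -- Serves twice: for a block inside `⟨ a , b ⟩`, and for the twisted binary form, obtained from a
  -- diagonal ternary form. Injectivity of `φ` keeps nonzero vectors nonzero.
  pullback-isPositiveDefinite :
    (∀ {x y} → x ≗ y → φ x ≗ φ y) → (∀ x y → φ (x S.+ᴹ y) ≗ φ x T.+ᴹ φ y) →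
    (∀ k x → φ (k S.*ₗ x) ≗ k T.*ₗ φ x) → (∀ x → φ x ≗ T.0ᴹ → x ≗ S.0ᴹ) →
    IsPositiveDefiniteForm (ℤ^ m) (λ x y → B (φ x) (φ y))
  pullback-isPositiveDefinite φ-cong φ-+ᴹ φ-*ₗ φ-injective = record
    { B-cong = λ x≗x′ y≗y′ → B-cong (φ-cong x≗x′) (φ-cong y≗y′)
    ; B-sym  = λ x y → B-sym (φ x) (φ y)
    ; B-+ᴹ   = λ x y z → trans (B-cong (φ-+ᴹ x y) (λ _ → refl)) (B-+ᴹ (φ x) (φ y) (φ z))
    ; B-*ₗ   = λ k x y → trans (B-cong (φ-*ₗ k x) (λ _ → refl)) (B-*ₗ k (φ x) (φ y))
    ; B-pos  = λ x x≢0 → B-pos (φ x) (x≢0 ∘ φ-injective x)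
    }

-- Blocks and the norms that sums of blocks avoid.

pattern 𝟎 = zero
pattern 𝟏 = suc zero
pattern 𝟐 = suc (suc zero)

square : ℤ → ℕ
square i = ∣ i ∣ ℕ.* ∣ i ∣

+square : ∀ i → i * i ≡ + square i
+square (+ n)       = sym (ℤ.pos-* n n)
+square ℤ.-[1+ n ] = refl

scaled-square : ∀ n i → + n * (i * i) ≡ + (n ℕ.* square i)
scaled-square n i = trans (cong (+ n *_) (+square i)) (sym (ℤ.pos-* n (square i)))

square≡0⇒≡0 : ∀ i → square i ≡ 0 → i ≡ 0ℤ
square≡0⇒≡0 i eq with ℕ.m*n≡0⇒m≡0∨n≡0 ∣ i ∣ eq
... | inj₁ e = ℤ.∣i∣≡0⇒i≡0 e
... | inj₂ e = ℤ.∣i∣≡0⇒i≡0 e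

square≡1⇒∣i∣≡1 : ∀ i → square i ≡ 1 → ∣ i ∣ ≡ 1
square≡1⇒∣i∣≡1 i = ℕ.m*n≡1⇒m≡1 ∣ i ∣ ∣ i ∣

≢0⇒1≤square : ∀ {i} → i ≢ 0ℤ → 1 ≤ square i
≢0⇒1≤square {i} i≢0 = ℕ.n≢0⇒n>0 (i≢0 ∘ square≡0⇒≡0 i)

∣unit⇒∣1 : ∀ {k i} → ∣ i ∣ ≡ 1 → k ∣ i → k ∣ 1ℤ
∣unit⇒∣1 {k} ∣i∣≡1 k∣i = ∣ᵤ⇒∣ {k} {1ℤ} (subst (∣ k ∣ ℕ.∣_) ∣i∣≡1 (∣⇒∣ᵤ k∣i))

2∤1 : ¬ (+ 2 ∣ 1ℤ)
2∤1 2∣1 with ℕ.∣1⇒≡1 (∣⇒∣ᵤ 2∣1)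
... | ()

-- The sublattice {(p X + q Y , r Y)} of ℤ², of finite index and containing neither (1 , 0) nor (0 , 1).
record Block : Set where
  field
    p q r : ℤ
    p≢0   : p ≢ 0ℤ
    r≢0   : r ≢ 0ℤ
    p∤1   : ¬ (p ∣ 1ℤ)
    r∣1⇒p∤q : r ∣ 1ℤ → ¬ (p ∣ q)

  embedding : Vector ℤ 2 → Vector ℤ 2
  embedding z = p * z 𝟎 + q * z 𝟏 ∷ r * z 𝟏 ∷ []

-- Such forms represent neither a nor b when a < b and a ∤ b.
Avoids : ∀ {k} → ℕ → ℕ → Form k → Set
Avoids a b B = ∀ z → ∃₂ λ s t →
  B z z ≡ + (a ℕ.* s ℕ.+ b ℕ.* t) × ¬ (s ≡ 1 × t ≡ 0) × ¬ (s ≡ 0 × t ≡ 1)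

-- The coefficient pairs of the two halves add. Natural numbers with sum `(1 , 0)` or `(0 , 1)`
-- force one half to have that same pair already.
⟂-avoids : ∀ {a b m n} {B : Form m} {B′ : Form n} →
           Avoids a b B → Avoids a b B′ → Avoids a b (B ⟂ B′)
⟂-avoids {a} {b} {m} avoids avoids′ z
  with s , t , eq , ¬10 , ¬01 ← avoids (take m z)
     | s′ , t′ , eq′ , ¬10′ , ¬01′ ← avoids′ (drop m z)
  = s ℕ.+ s′ , t ℕ.+ t′
  , trans (cong₂ _+_ eq eq′) (cong +_ (regroup a b s t s′ t′))
  , (λ (s≡1 , t≡0) → one-of s s′ t t′ s≡1 t≡0 ¬10 ¬10′)
  , (λ (s≡0 , t≡1) → one-of t t′ s s′ t≡1 s≡0 (¬01 ∘ swap) (¬01′ ∘ swap))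
  where
  regroup : ∀ a b s t s′ t′ → (a ℕ.* s ℕ.+ b ℕ.* t) ℕ.+ (a ℕ.* s′ ℕ.+ b ℕ.* t′) ≡
                              a ℕ.* (s ℕ.+ s′) ℕ.+ b ℕ.* (t ℕ.+ t′)
  regroup = ℕSolver.solve-∀

  one-of : ∀ s s′ t t′ → s ℕ.+ s′ ≡ 1 → t ℕ.+ t′ ≡ 0 →
           ¬ (s ≡ 1 × t ≡ 0) → ¬ (s′ ≡ 1 × t′ ≡ 0) → ⊥
  one-of zero          s′ t t′ e f ¬p ¬p′ = ¬p′ (e , ℕ.m+n≡0⇒n≡0 t f)
  one-of (suc zero)    s′ t t′ e f ¬p ¬p′ = ¬p (refl , ℕ.m+n≡0⇒m≡0 t f)
  one-of (suc (suc _)) s′ t t′ () f ¬p ¬p′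

module _ (a b : ℕ) where

  ab-form : Form 2
  ab-form = diagonalForm (a ∷ b ∷ [])

  blockForm : Block → Form 2
  blockForm K x y = ab-form (embedding x) (embedding y)
    where open Block K

  ab-norm : ∀ z → ab-form z z ≡ + (a ℕ.* square (z 𝟎) ℕ.+ b ℕ.* square (z 𝟏))
  ab-norm z = cong₂ _+_ (scaled-square a (z 𝟎))
    (trans (ℤ.+-identityʳ _) (scaled-square b (z 𝟏)))

  -- The coefficients are the squared coordinates of the embedded vector, so an excluded pair would
  -- place `(±1 , 0)` or `(0 , ±1)` in the block. The first makes `p` divide a unit; the second
  -- makes `r` a unit and `p` a divisor of `q`.
  blockForm-avoids : ∀ K → Avoids a b (blockForm K)
  blockForm-avoids K z = square (embedding z 𝟎) , square (embedding z 𝟏) , ab-norm (embedding z) , ¬10 , ¬01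
    where
    open Block K

    ¬10 : ¬ (square (p * z 𝟎 + q * z 𝟏) ≡ 1 × square (r * z 𝟏) ≡ 0)
    ¬10 (u≡1 , v≡0) with ℤ.i*j≡0⇒i≡0∨j≡0 r (square≡0⇒≡0 (r * z 𝟏) v≡0)
    ... | inj₁ r≡0 = r≢0 r≡0
    ... | inj₂ y≡0 = p∤1 (∣unit⇒∣1 (square≡1⇒∣i∣≡1 (p * z 𝟎 + q * z 𝟏) u≡1)
                       (divides (z 𝟎) (trans (cong (λ y → p * z 𝟎 + q * y) y≡0) (drop-y p q (z 𝟎)))))
      where
      drop-y : ∀ p q x → p * x + q * 0ℤ ≡ x * p
      drop-y = solve-∀

    ¬01 : ¬ (square (p * z 𝟎 + q * z 𝟏) ≡ 0 × square (r * z 𝟏) ≡ 1)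
    ¬01 (u≡0 , v≡1) = r∣1⇒p∤q (∣unit⇒∣1 ∣ry∣≡1 (divides (z 𝟏) (ℤ.*-comm r (z 𝟏)))) p∣q
      where
      ∣ry∣≡1 : ∣ r * z 𝟏 ∣ ≡ 1
      ∣ry∣≡1 = square≡1⇒∣i∣≡1 (r * z 𝟏) v≡1

      isolate : ∀ p q x y u → q * (u * y) ≡ u * (p * x + q * y) + - (u * x) * p
      isolate = solve-∀

      p∣q : p ∣ q
      -- As `r * z 𝟏` is a unit, so is `z 𝟏`, with inverse `u`; multiplying `p * z 𝟎 + q * z 𝟏 ≡ 0`
      -- by `u` exhibits `q` as a multiple of `p`.
      p∣q with divides u 1≡uy ← ∣unit⇒∣1 ∣ry∣≡1 (divides r refl) = divides (- (u * z 𝟎)) (begin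
        q                                               ≡⟨ ℤ.*-identityʳ q ⟨
        q * 1ℤ                                          ≡⟨ cong (q *_) 1≡uy ⟩
        q * (u * z 𝟏)                                   ≡⟨ isolate p q (z 𝟎) (z 𝟏) u ⟩
        u * (p * z 𝟎 + q * z 𝟏) + - (u * z 𝟎) * p       ≡⟨ cong (λ w → u * w + - (u * z 𝟎) * p) (square≡0⇒≡0 _ u≡0) ⟩
        u * 0ℤ + - (u * z 𝟎) * p                        ≡⟨ cong (_+ - (u * z 𝟎) * p) (ℤ.*-zeroʳ u) ⟩
        0ℤ + - (u * z 𝟎) * p                            ≡⟨ ℤ.+-identityˡ _ ⟩
        - (u * z 𝟎) * p                                 ∎)
        where open ≡-Reasoning

  blocksForm : ∀ {t} → Vector Block t → Form (t ℕ.* 2)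
  blocksForm {zero}  K = λ _ _ → 0ℤ
  blocksForm {suc t} K = blockForm (K zero) ⟂ blocksForm (K ∘ suc)

  blocksForm-avoids : ∀ {t} (K : Vector Block t) → Avoids a b (blocksForm K)
  blocksForm-avoids {zero}  K z = 0 , 0 , cong₂ (λ m n → + (m ℕ.+ n)) (sym (ℕ.*-zeroʳ a)) (sym (ℕ.*-zeroʳ b))
                                , (λ ()) , λ ()
  blocksForm-avoids {suc t} K   = ⟂-avoids {a} {b} {B = blockForm (K zero)} {B′ = blocksForm (K ∘ suc)}
    (blockForm-avoids (K zero)) (blocksForm-avoids (K ∘ suc))

  module _ (0<a : 0 < a) (0<b : 0 < b) where

    blockForm-isPositiveDefinite : ∀ K → IsPositiveDefiniteForm (ℤ^ 2) (blockForm K)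
    blockForm-isPositiveDefinite K =
      pullback-isPositiveDefinite (ℤ-Lattice.isPositiveDefiniteForm (⟨ a , b ⟩ 0<a 0<b)) embedding
        embedding-cong embedding-+ᴹ embedding-*ₗ embedding-injective
      where
      open Block K
      open LeftModule (ℤ^ 2)

      sum₊ : ∀ p q x x′ y y′ → p * (x + x′) + q * (y + y′) ≡ (p * x + q * y) + (p * x′ + q * y′)
      sum₊ = solve-∀
      sum* : ∀ k p q x y → p * (k * x) + q * (k * y) ≡ k * (p * x + q * y)
      sum* = solve-∀
      scale : ∀ k r y → r * (k * y) ≡ k * (r * y)
      scale = solve-∀

      embedding-cong : ∀ {x y} → x ≗ y → embedding x ≗ embedding y
      embedding-cong x≗y 𝟎 = cong₂ (λ s t → p * s + q * t) (x≗y 𝟎) (x≗y 𝟏)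
      embedding-cong x≗y 𝟏 = cong (r *_) (x≗y 𝟏)

      embedding-+ᴹ : ∀ x y → embedding (x +ᴹ y) ≗ embedding x +ᴹ embedding y
      embedding-+ᴹ x y 𝟎 = sum₊ p q (x 𝟎) (y 𝟎) (x 𝟏) (y 𝟏)
      embedding-+ᴹ x y 𝟏 = ℤ.*-distribˡ-+ r (x 𝟏) (y 𝟏)

      embedding-*ₗ : ∀ k x → embedding (k *ₗ x) ≗ k *ₗ embedding x
      embedding-*ₗ k x 𝟎 = sum* k p q (x 𝟎) (x 𝟏)
      embedding-*ₗ k x 𝟏 = scale k r (x 𝟏)

      -- The matrix of the embedding is triangular with nonzero diagonal entries `p` and `r`: first
      -- `r` is cancelled, then `p`.
      embedding-injective : ∀ x → embedding x ≗ 0ᴹ → x ≗ 0ᴹ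
      embedding-injective x eq with ℤ.i*j≡0⇒i≡0∨j≡0 r (eq 𝟏)
      ... | inj₁ r≡0 = contradiction r≡0 r≢0
      ... | inj₂ y≡0 with ℤ.i*j≡0⇒i≡0∨j≡0 p px≡0
        where
        px≡0 : p * x 𝟎 ≡ 0ℤ
        px≡0 = trans (sym (trans (cong (λ y → p * x 𝟎 + q * y) y≡0)
                 (trans (cong (_+_ (p * x 𝟎)) (ℤ.*-zeroʳ q)) (ℤ.+-identityʳ _)))) (eq 𝟎)
      ...   | inj₁ p≡0 = contradiction p≡0 p≢0
      ...   | inj₂ x≡0 = λ { 𝟎 → x≡0 ; 𝟏 → y≡0 }

    blocksForm-isPositiveDefinite : ∀ {t} (K : Vector Block t) → IsPositiveDefiniteForm (ℤ^ (t ℕ.* 2)) (blocksForm K)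
    blocksForm-isPositiveDefinite {zero} K = record
      { B-cong = λ _ _ → refl
      ; B-sym  = λ _ _ → refl
      ; B-+ᴹ   = λ _ _ _ → refl
      ; B-*ₗ   = λ k _ _ → sym (ℤ.*-zeroʳ k)
      ; B-pos  = λ x x≢0 → contradiction (λ ()) x≢0
      }
    blocksForm-isPositiveDefinite {suc t} K =
      ⟂-isPositiveDefinite (blockForm-isPositiveDefinite (K zero)) (blocksForm-isPositiveDefinite (K ∘ suc))

    inBlock : ∀ {t} → Fin t → Vector ℤ 2 → Vector ℤ (t ℕ.* 2)
    inBlock zero    z = z ++ LeftModule.0ᴹ (ℤ^ _)
    inBlock (suc i) z = LeftModule.0ᴹ (ℤ^ 2) ++ inBlock i z

    inBlock-isometry : ∀ {t} (K : Vector Block t) i x y →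
                       blocksForm K (inBlock i x) (inBlock i y) ≡ blockForm (K i) x y
    inBlock-isometry {suc t} K zero x y = trans
      (⟂-++ (blockForm-isPositiveDefinite (K zero)) pd x 0ᴹ y 0ᴹ)
      (trans (cong (_+_ (blockForm (K zero) x y)) (PositiveDefinite.B-0ᴹˡ pd 0ᴹ)) (ℤ.+-identityʳ _))
      where
      pd = blocksForm-isPositiveDefinite (K ∘ suc)
      open LeftModule (ℤ^ (t ℕ.* 2)) using (0ᴹ)
    inBlock-isometry {suc t} K (suc i) x y = trans
      (⟂-++ pd (blocksForm-isPositiveDefinite (K ∘ suc)) 0ᴹ (inBlock i x) 0ᴹ (inBlock i y))
      (trans (cong₂ _+_ (PositiveDefinite.B-0ᴹˡ pd 0ᴹ) (inBlock-isometry (K ∘ suc) i x y)) (ℤ.+-identityˡ _))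
      where
      pd = blockForm-isPositiveDefinite (K zero)
      open LeftModule (ℤ^ 2) using (0ᴹ)

-- Greatest common divisors and the values of linear functionals.

-- The identity for the absolute values is transported by multipliers `ε` and `η` with `∣ i ∣ = ε i`
-- and `∣ j ∣ = η j`. The divisor is stated as the combination itself, so that it can be read as the
-- value of a linear functional.
bézout : ∀ i j → ∃₂ λ α β → ((α * i + β * j) ∣ i) × ((α * i + β * j) ∣ j)
bézout i j with Bézout.lemma ∣ i ∣ ∣ j ∣ | signed i | signed j
  where
  signed : ∀ i → ∃ λ ε → + ∣ i ∣ ≡ ε * i
  signed i with ℤ.+∣i∣≡i⊎+∣i∣≡-i i
  ... | inj₁ eq = 1ℤ , trans eq (sym (ℤ.*-identityˡ i))
  ... | inj₂ eq = ℤ.-1ℤ , trans eq (sym (ℤ.-1*i≡-i i))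
... | Bézout.result d g identity | ε , ∣i∣≡εi | η , ∣j∣≡ηj with combination identity
  where
  rearrange : ∀ x ε i y η j d → d + y * (η * j) ≡ x * (ε * i) → (x * ε) * i + - (y * η) * j ≡ d
  rearrange x ε i y η j d eq = begin
    (x * ε) * i + - (y * η) * j              ≡⟨ regroup x ε i y η j ⟩
    x * (ε * i) + - (y * (η * j))            ≡⟨ cong (_+ - (y * (η * j))) eq ⟨
    d + y * (η * j) + - (y * (η * j))        ≡⟨ cancel d (y * (η * j)) ⟩
    d                                        ∎
    where
    open ≡-Reasoning
    regroup : ∀ x ε i y η j → (x * ε) * i + - (y * η) * j ≡ x * (ε * i) + - (y * (η * j))
    regroup = solve-∀
    cancel : ∀ d t → d + t + - t ≡ d
    cancel = solve-∀

  lift : ∀ x y m n → d ℕ.+ y ℕ.* n ≡ x ℕ.* m → + d + + y * + n ≡ + x * + m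
  lift x y m n eq = trans (cong (_+_ (+ d)) (sym (ℤ.pos-* y n))) (trans (cong +_ eq) (ℤ.pos-* x m))

  combination : Bézout.Identity d ∣ i ∣ ∣ j ∣ → ∃₂ λ α β → α * i + β * j ≡ + d
  combination (Bézout.+- x y eq) = + x * ε , - (+ y * η) ,
    rearrange (+ x) ε i (+ y) η j (+ d)
      (subst₂ (λ s t → + d + + y * t ≡ + x * s) ∣i∣≡εi ∣j∣≡ηj (lift x y ∣ i ∣ ∣ j ∣ eq))
  combination (Bézout.-+ x y eq) = - (+ x * ε) , + y * η ,
    trans (ℤ.+-comm (- (+ x * ε) * i) (+ y * η * j))
      (rearrange (+ y) η j (+ x) ε i (+ d)
        (subst₂ (λ s t → + d + + x * s ≡ + y * t) ∣i∣≡εi ∣j∣≡ηj (lift y x ∣ j ∣ ∣ i ∣ eq)))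
... | α , β , eq = α , β ,
  subst (_∣ i) (sym eq) (∣ᵤ⇒∣ (proj₁ (GCD.commonDivisor g))) ,
  subst (_∣ j) (sym eq) (∣ᵤ⇒∣ (proj₂ (GCD.commonDivisor g)))

module _ (M : ℤ-Module) where
  open LeftModule M

  record IsLinearFunctional (f : Carrierᴹ → ℤ) : Set where
    field
      f-cong : ∀ {x y} → x ≈ᴹ y → f x ≡ f y
      f-+ᴹ   : ∀ x y → f (x +ᴹ y) ≡ f x + f y
      f-*ₗ   : ∀ k x → f (k *ₗ x) ≡ k * f x

  module _ {f : Carrierᴹ → ℤ} (linear : IsLinearFunctional f) where
    open IsLinearFunctional linear

    -- The values of `f` on a span form a principal ideal. By induction, the generator for the tail
    -- and the value at the new vector are replaced by their gcd, which `bézout` realises as a value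
    -- of `f`.
    combination-generator : ∀ {n} (v : Vector Carrierᴹ n) → ∃ λ x → ∀ c → f x ∣ f (linearCombination M c v)
    combination-generator {zero}  v = 0ᴹ , λ c → ∣-refl
    combination-generator {suc n} v with combination-generator (v ∘ suc)
    ... | y , fy∣ with bézout (f (v zero)) (f y)
    ...   | α , β , g∣fv , g∣fy = α *ₗ v zero +ᴹ β *ₗ y , λ c →
      subst₂ _∣_ (sym fx≡) (sym (f-+ᴹ (c zero *ₗ v zero) _))
        (∣m∣n⇒∣m+n
          (subst (_ ∣_) (sym (f-*ₗ (c zero) (v zero))) (∣n⇒∣m*n (c zero) g∣fv))
          (∣-trans g∣fy (fy∣ (c ∘ suc))))
      where
      fx≡ : f (α *ₗ v zero +ᴹ β *ₗ y) ≡ α * f (v zero) + β * f y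
      fx≡ = trans (f-+ᴹ _ _) (cong₂ _+_ (f-*ₗ α (v zero)) (f-*ₗ β y))

    -- If f vanishes identically, the modulus g = 2 will do.
    image-modulus : ∀ {n} → IsFreeOfRank M n →
      ∃ λ g → (g ≢ 0ℤ) × (∀ x → g ∣ f x) × (g ∣ 1ℤ → ∃ λ x → f x ≡ 1ℤ)
    image-modulus (v , isBasis) with combination-generator v
    ... | x , fx∣ = choose (f x ℤ.≟ 0ℤ)
      where
      fx∣f : ∀ y → f x ∣ f y
      fx∣f y with c , y≈ ← IsBasis.spanning isBasis y = subst (f x ∣_) (sym (f-cong y≈)) (fx∣ c)

      choose : Dec (f x ≡ 0ℤ) → ∃ λ g → (g ≢ 0ℤ) × (∀ x → g ∣ f x) × (g ∣ 1ℤ → ∃ λ x → f x ≡ 1ℤ)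
      choose (yes fx≡0) = + 2 , (λ ())
        , (λ y → divides 0ℤ (0∣⇒≡0 (subst (_∣ f y) fx≡0 (fx∣f y))))
        , λ 2∣1 → contradiction 2∣1 2∤1
      choose (no fx≢0) = f x , fx≢0 , fx∣f
        , λ (divides u 1≡u*fx) → u *ₗ x , trans (f-*ₗ u x) (sym 1≡u*fx)

-- The twisted binary form.

module _ (a′ b′ : ℕ) where

  -- (x , y) has norm a x² + 2 x y + b y², where a = 1 + a′ and b = 1 + b′.
  twisted-coordinates : Vector ℤ 2 → Vector ℤ 3
  twisted-coordinates x = x 𝟎 ∷ x 𝟎 + x 𝟏 ∷ x 𝟏 ∷ []

  twistedForm : Form 2
  twistedForm x y = diagonalForm (a′ ∷ 1 ∷ b′ ∷ []) (twisted-coordinates x) (twisted-coordinates y)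

  twistedForm-isPositiveDefinite : 0 < a′ → 0 < b′ → IsPositiveDefiniteForm (ℤ^ 2) twistedForm
  twistedForm-isPositiveDefinite 0<a′ 0<b′ =
    pullback-isPositiveDefinite (diagonalForm-isPositiveDefinite (a′ ∷ 1 ∷ b′ ∷ []) 0<entries)
      twisted-coordinates
      (λ { x≗y 𝟎 → x≗y 𝟎 ; x≗y 𝟏 → cong₂ _+_ (x≗y 𝟎) (x≗y 𝟏) ; x≗y 𝟐 → x≗y 𝟏 })
      (λ { x y 𝟎 → refl ; x y 𝟏 → interchange (x 𝟎) (y 𝟎) (x 𝟏) (y 𝟏) ; x y 𝟐 → refl })
      (λ { k x 𝟎 → refl ; k x 𝟏 → sym (ℤ.*-distribˡ-+ k (x 𝟎) (x 𝟏)) ; k x 𝟐 → refl })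
      (λ { x eq 𝟎 → eq 𝟎 ; x eq 𝟏 → eq 𝟐 })
    where
    0<entries : ∀ i → 0 < (a′ ∷ 1 ∷ b′ ∷ []) i
    0<entries 𝟎 = 0<a′
    0<entries 𝟏 = ℕ.z<s
    0<entries 𝟐 = 0<b′

  -- Splitting a proper sublattice between the twisted form and one block.

  module _ (0<a : 0 < suc a′) (0<b : 0 < suc b′) (P : Sublattice (⟨ suc a′ , suc b′ ⟩ 0<a 0<b)) where
    private
      module P = Sublattice P
      module PL = ℤ-Lattice P.lattice
    open IsSubmodule P.isSubmodule

    -- Only inner products are recorded: `isometry⇒represents` later derives the linearity of the
    -- combined map.
    SplitsInto : Block → Set
    SplitsInto K = ∃₂ λ (σ κ : PL.Carrierᴹ → Vector ℤ 2) → ∀ x y →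
      twistedForm (σ x) (σ y) + blockForm (suc a′) (suc b′) K (κ x) (κ y) ≡ PL.B x y

    second-coordinate : PL.Carrierᴹ → ℤ
    second-coordinate x = proj₁ x 𝟏

    second-coordinate-linear : IsLinearFunctional PL.ℤ-module second-coordinate
    second-coordinate-linear = record
      { f-cong = λ x≗y → x≗y 𝟏 ; f-+ᴹ = λ _ _ → refl ; f-*ₗ = λ _ _ → refl }

    -- What remains of the first coordinate after subtracting the multiple of `(s , 1)` that cancels
    -- the second.
    shear : ℤ → PL.Carrierᴹ → ℤ
    shear s x = proj₁ x 𝟎 + - (s * proj₁ x 𝟏)

    shear-linear : ∀ s → IsLinearFunctional PL.ℤ-module (shear s)
    shear-linear s = record
      { f-cong = λ x≗y → cong₂ (λ t u → t + - (s * u)) (x≗y 𝟎) (x≗y 𝟏)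
      ; f-+ᴹ = λ x y → add s (proj₁ x 𝟎) (proj₁ y 𝟎) (proj₁ x 𝟏) (proj₁ y 𝟏)
      ; f-*ₗ = λ k x → mul s k (proj₁ x 𝟎) (proj₁ x 𝟏)
      }
      where
      add : ∀ s x x′ y y′ → (x + x′) + - (s * (y + y′)) ≡ (x + - (s * y)) + (x′ + - (s * y′))
      add = solve-∀
      mul : ∀ s k x y → k * x + - (s * (k * y)) ≡ k * (x + - (s * y))
      mul = solve-∀

    -- With `e = (s , 1)`, the vector `h - h₁ e` is `(shear s h , 0) = (1 , 0)`, and these two
    -- generate ℤ².
    shear-generators⇒full : ∀ (e h : PL.Carrierᴹ) → second-coordinate e ≡ 1ℤ →
      shear (proj₁ e 𝟎) h ≡ 1ℤ → ∀ x → P.mem x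
    shear-generators⇒full (e , e∈P) (h , h∈P) e₁≡1 shear≡1 x =
      resp (λ { 𝟎 → first ; 𝟏 → second })
        (+ᴹ-closed (*ₗ-closed (x 𝟏) e∈P)
          (*ₗ-closed (x 𝟎 + - (e 𝟎 * x 𝟏)) (+ᴹ-closed h∈P (*ₗ-closed (- h 𝟏) e∈P))))
      where
      open ≡-Reasoning
      collect₀ : ∀ x y s h k → y * s + (x + - (s * y)) * (h + - k * s) ≡ y * s + (x + - (s * y)) * (h + - (s * k))
      collect₀ = solve-∀
      cancel₀ : ∀ x y s → y * s + (x + - (s * y)) * 1ℤ ≡ x
      cancel₀ = solve-∀
      cancel₁ : ∀ x y s k → y * 1ℤ + (x + - (s * y)) * (k + - k * 1ℤ) ≡ y
      cancel₁ = solve-∀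

      first : x 𝟏 * e 𝟎 + (x 𝟎 + - (e 𝟎 * x 𝟏)) * (h 𝟎 + - h 𝟏 * e 𝟎) ≡ x 𝟎
      first = begin
        _ ≡⟨ collect₀ (x 𝟎) (x 𝟏) (e 𝟎) (h 𝟎) (h 𝟏) ⟩
        _ ≡⟨ cong (λ t → x 𝟏 * e 𝟎 + (x 𝟎 + - (e 𝟎 * x 𝟏)) * t) shear≡1 ⟩
        _ ≡⟨ cancel₀ (x 𝟎) (x 𝟏) (e 𝟎) ⟩
        x 𝟎 ∎

      second : x 𝟏 * e 𝟏 + (x 𝟎 + - (e 𝟎 * x 𝟏)) * (h 𝟏 + - h 𝟏 * e 𝟏) ≡ x 𝟏
      second = begin
        _ ≡⟨ cong (λ t → x 𝟏 * t + (x 𝟎 + - (e 𝟎 * x 𝟏)) * (h 𝟏 + - h 𝟏 * t)) e₁≡1 ⟩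
        _ ≡⟨ cancel₁ (x 𝟎) (x 𝟏) (e 𝟎) (h 𝟏) ⟩
        x 𝟏 ∎

    -- The first coordinate is carried by the twisted vector `(1 , 0)` of norm `suc a′`, and the
    -- second, a multiple of `g`, by the block.
    horizontal-splits : ∀ {g} → g ≢ 0ℤ → ¬ (g ∣ 1ℤ) → (∀ x → g ∣ second-coordinate x) → ∃ SplitsInto
    horizontal-splits {g} g≢0 g∤1 g∣y = K , σ , κ , isometry
      where
      K : Block
      -- Any nonzero non-unit would serve as `p`; `r∣1⇒p∤q` holds because `r = g` is not a unit.
      K = record { p = + 2 ; q = 0ℤ ; r = g ; p≢0 = λ () ; r≢0 = g≢0 ; p∤1 = 2∤1
                 ; r∣1⇒p∤q = λ g∣1 _ → g∤1 g∣1 }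
      σ κ : PL.Carrierᴹ → Vector ℤ 2
      σ x = proj₁ x 𝟎 ∷ 0ℤ ∷ []
      κ x = 0ℤ ∷ _∣_.quotient (g∣y x) ∷ []
      expand : ∀ A B x x′ u u′ g →
        (A * (x * x′) + (1ℤ * ((x + 0ℤ) * (x′ + 0ℤ)) + (B * (0ℤ * 0ℤ) + 0ℤ))) +
        ((1ℤ + A) * ((0ℤ + 0ℤ * u) * (0ℤ + 0ℤ * u′)) + ((1ℤ + B) * ((g * u) * (g * u′)) + 0ℤ))
        ≡ (1ℤ + A) * (x * x′) + ((1ℤ + B) * ((u * g) * (u′ * g)) + 0ℤ)
      expand = solve-∀
      isometry : ∀ x y → twistedForm (σ x) (σ y) + blockForm (suc a′) (suc b′) K (κ x) (κ y) ≡ PL.B x y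
      isometry x y = trans
        (expand (+ a′) (+ b′) (proj₁ x 𝟎) (proj₁ y 𝟎) (_∣_.quotient (g∣y x)) (_∣_.quotient (g∣y y)) g)
        (sym (cong₂ (λ s t → + suc a′ * (proj₁ x 𝟎 * proj₁ y 𝟎) + (+ suc b′ * (s * t) + 0ℤ))
          (_∣_.equality (g∣y x)) (_∣_.equality (g∣y y))))

    -- The mirror image: the twisted vector `(0 , 1)` of norm `suc b′` carries the second
    -- coordinate.
    vertical-splits : ∀ {g} → g ≢ 0ℤ → ¬ (g ∣ 1ℤ) → (∀ x → g ∣ proj₁ x 𝟎) → ∃ SplitsInto
    vertical-splits {g} g≢0 g∤1 g∣x = K , σ , κ , isometry
      where
      K : Block
      K = record { p = g ; q = 0ℤ ; r = + 2 ; p≢0 = g≢0 ; r≢0 = λ () ; p∤1 = g∤1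
                 ; r∣1⇒p∤q = λ 2∣1 _ → 2∤1 2∣1 }
      σ κ : PL.Carrierᴹ → Vector ℤ 2
      σ x = 0ℤ ∷ proj₁ x 𝟏 ∷ []
      κ x = _∣_.quotient (g∣x x) ∷ 0ℤ ∷ []
      expand : ∀ A B y y′ u u′ g →
        (A * (0ℤ * 0ℤ) + (1ℤ * ((0ℤ + y) * (0ℤ + y′)) + (B * (y * y′) + 0ℤ))) +
        ((1ℤ + A) * ((g * u + 0ℤ) * (g * u′ + 0ℤ)) + ((1ℤ + B) * (0ℤ * 0ℤ) + 0ℤ))
        ≡ (1ℤ + A) * ((u * g) * (u′ * g)) + ((1ℤ + B) * (y * y′) + 0ℤ)
      expand = solve-∀
      isometry : ∀ x y → twistedForm (σ x) (σ y) + blockForm (suc a′) (suc b′) K (κ x) (κ y) ≡ PL.B x y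
      isometry x y = trans
        (expand (+ a′) (+ b′) (proj₁ x 𝟏) (proj₁ y 𝟏) (_∣_.quotient (g∣x x)) (_∣_.quotient (g∣x y)) g)
        (sym (cong₂ (λ s t → + suc a′ * (s * t) + (+ suc b′ * (proj₁ x 𝟏 * proj₁ y 𝟏) + 0ℤ))
          (_∣_.equality (g∣x x)) (_∣_.equality (g∣x y))))

    -- The block alone contains the sublattice, since `(x , y) = (g u + s y , y)` when
    -- `x - s y = g u`. The condition `¬ (g ∣ s)` keeps `(0 , 1)` out of it.
    oblique-splits : ∀ {g s} → g ≢ 0ℤ → ¬ (g ∣ 1ℤ) → ¬ (g ∣ s) → (∀ x → g ∣ shear s x) → ∃ SplitsInto
    oblique-splits {g} {s} g≢0 g∤1 g∤s g∣shear = K , (λ _ → LeftModule.0ᴹ (ℤ^ 2)) , κ , isometry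
      where
      K : Block
      K = record { p = g ; q = s ; r = 1ℤ ; p≢0 = g≢0 ; r≢0 = λ () ; p∤1 = g∤1
                 ; r∣1⇒p∤q = λ _ → g∤s }
      κ : PL.Carrierᴹ → Vector ℤ 2
      κ x = _∣_.quotient (g∣shear x) ∷ proj₁ x 𝟏 ∷ []
      restore : ∀ s x y → x + - (s * y) + s * y ≡ x
      restore = solve-∀
      embedding-κ : ∀ x → Block.embedding K (κ x) ≗ proj₁ x
      embedding-κ x 𝟎 = trans
        (cong (_+ s * proj₁ x 𝟏) (trans (ℤ.*-comm g (_∣_.quotient (g∣shear x))) (sym (_∣_.equality (g∣shear x)))))
        (restore s (proj₁ x 𝟎) (proj₁ x 𝟏))
      embedding-κ x 𝟏 = ℤ.*-identityˡ (proj₁ x 𝟏)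
      expand : ∀ A B → A * (0ℤ * 0ℤ) + (1ℤ * ((0ℤ + 0ℤ) * (0ℤ + 0ℤ)) + (B * (0ℤ * 0ℤ) + 0ℤ)) ≡ 0ℤ
      expand = solve-∀
      isometry : ∀ x y → twistedForm (λ _ → 0ℤ) (λ _ → 0ℤ) + blockForm (suc a′) (suc b′) K (κ x) (κ y) ≡ PL.B x y
      isometry x y = trans
        (cong₂ _+_ (expand (+ a′) (+ b′))
          (ℤ-Lattice.B-cong (⟨ suc a′ , suc b′ ⟩ 0<a 0<b) (embedding-κ x) (embedding-κ y)))
        (ℤ.+-identityˡ _)

    proper⇒splits : P.Proper → ∃ SplitsInto
    proper⇒splits proper with image-modulus PL.ℤ-module second-coordinate-linear P.isFree
    ... | g , g≢0 , g∣y , g-unit with g ∣? 1ℤ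
    ...   | no  g∤1 = horizontal-splits g≢0 g∤1 g∣y
    ...   | yes g∣1 with g-unit g∣1
    ...     | e , e₁≡1 with image-modulus PL.ℤ-module (shear-linear (proj₁ e 𝟎)) P.isFree
    ...       | d , d≢0 , d∣shear , d-unit with d ∣? 1ℤ | d ∣? proj₁ e 𝟎
    -- A unit `d` yields a vector with shear 1, which together with `e` generates all of ℤ².
    ...         | yes d∣1 | _ = contradiction
                    (let h , shear≡1 = d-unit d∣1 in shear-generators⇒full e h e₁≡1 shear≡1) proper
    ...         | no  d∤1 | no  d∤s = oblique-splits d≢0 d∤1 d∤s d∣shear
    -- When `d` divides `s`, the congruence `x ≡ s y` modulo `d` reduces to `d ∣ x`.
    ...         | no  d∤1 | yes d∣s = vertical-splits d≢0 d∤1 λ x →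
                    subst (d ∣_) (restore (proj₁ x 𝟎) (proj₁ e 𝟎) (proj₁ x 𝟏))
                      (∣m∣n⇒∣m+n (d∣shear x) (∣n⇒∣m*n (proj₁ x 𝟏) d∣s))
      where
      restore : ∀ x s y → x + - (s * y) + y * s ≡ x
      restore = solve-∀

  -- Short vectors of the twisted form.

  twisted-norm : ∀ x → twistedForm x x ≡
    + (a′ ℕ.* square (x 𝟎) ℕ.+ (square (x 𝟎 + x 𝟏) ℕ.+ b′ ℕ.* square (x 𝟏)))
  twisted-norm x = cong₂ _+_ (scaled-square a′ (x 𝟎)) (cong₂ _+_
    (trans (ℤ.*-identityˡ _) (+square (x 𝟎 + x 𝟏)))
    (trans (ℤ.+-identityʳ _) (scaled-square b′ (x 𝟏))))

  -- The factor in brackets is the row `(suc a′ , 1)` of the Gram matrix applied to `y`. It gives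
  -- the norm of `x` when `y = x`, and otherwise the orthogonality condition.
  twisted-product : ∀ x y → x 𝟏 ≡ 0ℤ → twistedForm x y ≡ x 𝟎 * (+ suc a′ * y 𝟎 + y 𝟏)
  twisted-product x y x₁≡0 = trans
    (cong (λ t → + a′ * (x 𝟎 * y 𝟎) + (1ℤ * ((x 𝟎 + t) * (y 𝟎 + y 𝟏)) + (+ b′ * (t * y 𝟏) + 0ℤ))) x₁≡0)
    (expand (+ a′) (+ b′) (x 𝟎) (y 𝟎) (y 𝟏))
    where
    expand : ∀ A B x y y′ → A * (x * y) + (1ℤ * ((x + 0ℤ) * (y + y′)) + (B * (0ℤ * y′) + 0ℤ)) ≡ x * ((1ℤ + A) * y + y′)
    expand = solve-∀

  module _ (1≤a′ : 1 ≤ a′) (a′<b′ : a′ < b′) where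

    -- Here `f` stands for the norm of a component outside the twisted lattice. If `x 𝟏` is nonzero,
    -- `x 𝟎` and `x 𝟎 + x 𝟏` are not both zero, so the norm is at least `1 + b′`, too large.
    -- Otherwise it is `suc a′` times a square; a zero square would leave `suc a′` to `f`, and a
    -- nonzero one leaves nothing.
    shortest-twisted : ∀ x f → twistedForm x x + + f ≡ + suc a′ → f ≢ suc a′ →
                       x 𝟎 ≢ 0ℤ × x 𝟏 ≡ 0ℤ × f ≡ 0
    shortest-twisted x f eq f≢a with x 𝟏 ℤ.≟ 0ℤ
    ... | no x₁≢0 = contradiction norm≡a (ℕ.>⇒≢ (begin-strict
      suc a′                        <⟨ ℕ.s<s a′<b′ ⟩
      1 ℕ.+ b′                      ≤⟨ ℕ.+-mono-≤ 1≤X+W (ℕ.m≤m*n b′ Y {{ℕ.>-nonZero (≢0⇒1≤square x₁≢0)}}) ⟩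
      X ℕ.+ W ℕ.+ b′ ℕ.* Y          ≤⟨ ℕ.+-monoˡ-≤ (b′ ℕ.* Y) (ℕ.+-monoˡ-≤ W (ℕ.m≤n*m X a′ {{ℕ.>-nonZero 1≤a′}})) ⟩
      a′ ℕ.* X ℕ.+ W ℕ.+ b′ ℕ.* Y   ≡⟨ ℕ.+-assoc (a′ ℕ.* X) W _ ⟩
      a′ ℕ.* X ℕ.+ (W ℕ.+ b′ ℕ.* Y) ≤⟨ ℕ.m≤m+n _ f ⟩
      a′ ℕ.* X ℕ.+ (W ℕ.+ b′ ℕ.* Y) ℕ.+ f ∎))
      where
      open ℕ.≤-Reasoning
      X W Y : ℕ
      X = square (x 𝟎)
      W = square (x 𝟎 + x 𝟏)
      Y = square (x 𝟏)
      norm≡a : a′ ℕ.* X ℕ.+ (W ℕ.+ b′ ℕ.* Y) ℕ.+ f ≡ suc a′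
      norm≡a = ℤ.+-injective (trans (cong (_+ + f) (sym (twisted-norm x))) eq)
      1≤X+W : 1 ≤ X ℕ.+ W
      1≤X+W with x 𝟎 ℤ.≟ 0ℤ
      ... | no  x₀≢0 = ℕ.≤-trans (≢0⇒1≤square x₀≢0) (ℕ.m≤m+n X W)
      ... | yes x₀≡0 = ℕ.≤-trans (≢0⇒1≤square x₀+x₁≢0) (ℕ.m≤n+m W X)
        where
        x₀+x₁≢0 : x 𝟎 + x 𝟏 ≢ 0ℤ
        x₀+x₁≢0 sum≡0 = x₁≢0 (trans (sym (trans (cong (_+ x 𝟏) x₀≡0) (ℤ.+-identityˡ _))) sum≡0)
    ... | yes x₁≡0 = x₀≢0 , x₁≡0 , f≡0
      where
      X : ℕ
      X = square (x 𝟎)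
      norm≡a : suc a′ ℕ.* X ℕ.+ f ≡ suc a′
      norm≡a = ℤ.+-injective (trans (cong (_+ + f) (begin
        + (suc a′ ℕ.* X)                          ≡⟨ scaled-square (suc a′) (x 𝟎) ⟨
        + suc a′ * (x 𝟎 * x 𝟎)                    ≡⟨ regroup (+ suc a′) (x 𝟎) ⟩
        x 𝟎 * (+ suc a′ * x 𝟎 + 0ℤ)               ≡⟨ cong (λ t → x 𝟎 * (+ suc a′ * x 𝟎 + t)) x₁≡0 ⟨
        x 𝟎 * (+ suc a′ * x 𝟎 + x 𝟏)              ≡⟨ twisted-product x x x₁≡0 ⟨
        twistedForm x x                           ∎)) eq)
        where
        open ≡-Reasoning
        regroup : ∀ a x → a * (x * x) ≡ x * (a * x + 0ℤ)
        regroup = solve-∀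
      x₀≢0 : x 𝟎 ≢ 0ℤ
      x₀≢0 x₀≡0 = f≢a (trans (sym (trans (cong (λ t → suc a′ ℕ.* square t ℕ.+ f) x₀≡0)
        (cong (ℕ._+ f) (ℕ.*-zeroʳ a′)))) norm≡a)
      f≡0 : f ≡ 0
      f≡0 = ℕ.n≤0⇒n≡0 (ℕ.+-cancelˡ-≤ (suc a′) f 0 (begin
        suc a′ ℕ.+ f          ≤⟨ ℕ.+-monoˡ-≤ f (ℕ.m≤m*n (suc a′) X {{ℕ.>-nonZero (≢0⇒1≤square x₀≢0)}}) ⟩
        suc a′ ℕ.* X ℕ.+ f    ≡⟨ norm≡a ⟩
        suc a′                ≡⟨ ℕ.+-identityʳ _ ⟨
        suc a′ ℕ.+ 0          ∎))
        where open ℕ.≤-Reasoning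

    -- Orthogonality forces `y 𝟏 = - (suc a′ * y 𝟎)`. If `y 𝟎` were nonzero, then `∣ y 𝟏 ∣` would be
    -- at least 2 and the norm at least `2 b′`, exceeding `suc b′`. So `y` vanishes and `f` is the
    -- whole norm.
    orthogonal-twisted : ∀ x y f → x 𝟎 ≢ 0ℤ → x 𝟏 ≡ 0ℤ → twistedForm x y ≡ 0ℤ →
                         twistedForm y y + + f ≡ + suc b′ → f ≡ suc b′
    orthogonal-twisted x y f x₀≢0 x₁≡0 xy≡0 eq with ℤ.i*j≡0⇒i≡0∨j≡0 (x 𝟎) (trans (sym (twisted-product x y x₁≡0)) xy≡0)
    ... | inj₁ x₀≡0 = contradiction x₀≡0 x₀≢0
    ... | inj₂ ay₀+y₁≡0 with y 𝟎 ℤ.≟ 0ℤ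
    ...   | yes y₀≡0 = ℤ.+-injective (begin
      + f                      ≡⟨ cong (_+ + f) y²≡0 ⟨
      twistedForm y y + + f    ≡⟨ eq ⟩
      + suc b′                 ∎)
      where
      open ≡-Reasoning
      y₁≡0 : y 𝟏 ≡ 0ℤ
      y₁≡0 = trans (sym (trans (cong (λ t → + suc a′ * t + y 𝟏) y₀≡0)
        (trans (cong (_+ y 𝟏) (ℤ.*-zeroʳ (+ suc a′))) (ℤ.+-identityˡ _)))) ay₀+y₁≡0
      y²≡0 : twistedForm y y ≡ 0ℤ
      y²≡0 = trans (twisted-product y y y₁≡0) (cong (_* (+ suc a′ * y 𝟎 + y 𝟏)) y₀≡0)
    ...   | no  y₀≢0 = contradiction norm≡b (ℕ.>⇒≢ (begin-strict
      -- This is `1 < b′`, from `1 ≤ a′ < b′`.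
      suc b′                          <⟨ ℕ.+-monoˡ-< b′ (ℕ.≤-<-trans 1≤a′ a′<b′) ⟩
      b′ ℕ.+ b′                       ≡⟨ cong (b′ ℕ.+_) (ℕ.+-identityʳ b′) ⟨
      2 ℕ.* b′                        ≡⟨ ℕ.*-comm 2 b′ ⟩
      b′ ℕ.* 2                        ≤⟨ ℕ.*-monoʳ-≤ b′ 2≤Y ⟩
      b′ ℕ.* Y                        ≤⟨ ℕ.m≤n+m _ W ⟩
      W ℕ.+ b′ ℕ.* Y                  ≤⟨ ℕ.m≤n+m _ (a′ ℕ.* X) ⟩
      a′ ℕ.* X ℕ.+ (W ℕ.+ b′ ℕ.* Y)   ≤⟨ ℕ.m≤m+n _ f ⟩
      a′ ℕ.* X ℕ.+ (W ℕ.+ b′ ℕ.* Y) ℕ.+ f ∎))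
      where
      open ℕ.≤-Reasoning
      X W Y : ℕ
      X = square (y 𝟎)
      W = square (y 𝟎 + y 𝟏)
      Y = square (y 𝟏)
      norm≡b : a′ ℕ.* X ℕ.+ (W ℕ.+ b′ ℕ.* Y) ℕ.+ f ≡ suc b′
      norm≡b = ℤ.+-injective (trans (cong (_+ + f) (sym (twisted-norm y))) eq)
      y₁≡-ay₀ : y 𝟏 ≡ - (+ suc a′ * y 𝟎)
      y₁≡-ay₀ = inverseʳ-unique ℤ.+-0-abelianGroup (+ suc a′ * y 𝟎) (y 𝟏) ay₀+y₁≡0
      2≤∣y₁∣ : 2 ≤ ∣ y 𝟏 ∣
      2≤∣y₁∣ = begin
        2                      ≤⟨ ℕ.s≤s 1≤a′ ⟩
        suc a′                 ≤⟨ ℕ.m≤m*n (suc a′) ∣ y 𝟎 ∣ {{ℕ.≢-nonZero (y₀≢0 ∘ ℤ.∣i∣≡0⇒i≡0)}} ⟩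
        suc a′ ℕ.* ∣ y 𝟎 ∣     ≡⟨ ℤ.abs-* (+ suc a′) (y 𝟎) ⟨
        ∣ + suc a′ * y 𝟎 ∣     ≡⟨ ℤ.∣-i∣≡∣i∣ (+ suc a′ * y 𝟎) ⟨
        ∣ - (+ suc a′ * y 𝟎) ∣ ≡⟨ cong ∣_∣ y₁≡-ay₀ ⟨
        ∣ y 𝟏 ∣                ∎
      2≤Y : 2 ≤ Y
      2≤Y = ℕ.≤-trans 2≤∣y₁∣ (ℕ.m≤m*n ∣ y 𝟏 ∣ ∣ y 𝟏 ∣ {{ℕ.>-nonZero (ℕ.≤-trans (ℕ.n≤1+n 1) 2≤∣y₁∣)}})

-- Excluding a representation of the full lattice.

-- For `t = 0`, cancelling `a` leaves the excluded pair; for positive `t` the value is at least `b`,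
-- hence above `a`.
combination≢a : ∀ {a b} → 0 < a → a < b → ∀ s t → ¬ (s ≡ 1 × t ≡ 0) → a ℕ.* s ℕ.+ b ℕ.* t ≢ a
combination≢a {a} {b} 0<a a<b s zero    ¬10 eq = ¬10 (ℕ.*-cancelˡ-≡ s 1 a {{ℕ.>-nonZero 0<a}} (begin
  a ℕ.* s              ≡⟨ ℕ.+-identityʳ _ ⟨
  a ℕ.* s ℕ.+ 0        ≡⟨ cong (a ℕ.* s ℕ.+_) (ℕ.*-zeroʳ b) ⟨
  a ℕ.* s ℕ.+ b ℕ.* 0  ≡⟨ eq ⟩
  a                    ≡⟨ ℕ.*-identityʳ a ⟨
  a ℕ.* 1              ∎) , refl)
  where open ≡-Reasoning
combination≢a {a} {b} 0<a a<b s (suc t) ¬10 = ℕ.>⇒≢ (begin-strict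
  a                          <⟨ a<b ⟩
  b                          ≤⟨ ℕ.m≤m*n b (suc t) ⟩
  b ℕ.* suc t                ≤⟨ ℕ.m≤n+m _ (a ℕ.* s) ⟩
  a ℕ.* s ℕ.+ b ℕ.* suc t    ∎)
  where open ℕ.≤-Reasoning

-- The case `t = 0` would make `a` divide `b`. For `t = 1` only the excluded pair gives `b`, and for
-- larger `t` the value exceeds `b`.
combination≢b : ∀ {a b} → 0 < a → 0 < b → a ∤ b → ∀ s t → ¬ (s ≡ 0 × t ≡ 1) → a ℕ.* s ℕ.+ b ℕ.* t ≢ b
combination≢b {a} {b} 0<a 0<b a∤b s zero ¬01 eq = a∤b (ℕ.divides s (begin
  b                    ≡⟨ eq ⟨
  a ℕ.* s ℕ.+ b ℕ.* 0  ≡⟨ cong (a ℕ.* s ℕ.+_) (ℕ.*-zeroʳ b) ⟩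
  a ℕ.* s ℕ.+ 0        ≡⟨ ℕ.+-identityʳ _ ⟩
  a ℕ.* s              ≡⟨ ℕ.*-comm a s ⟩
  s ℕ.* a              ∎))
  where open ≡-Reasoning
combination≢b {a} {b} 0<a 0<b a∤b zero (suc zero) ¬01 eq = ¬01 (refl , refl)
combination≢b {a} {b} 0<a 0<b a∤b (suc s) (suc zero) ¬01 = ℕ.>⇒≢ (begin-strict
  b                            ≡⟨ ℕ.*-identityʳ b ⟨
  b ℕ.* 1                      <⟨ ℕ.+-monoˡ-≤ (b ℕ.* 1) (ℕ.≤-trans 0<a (ℕ.m≤m*n a (suc s))) ⟩
  a ℕ.* suc s ℕ.+ b ℕ.* 1      ∎)
  where open ℕ.≤-Reasoning
combination≢b {a} {b} 0<a 0<b a∤b s (suc (suc t)) ¬01 = ℕ.>⇒≢ (begin-strict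
  b                                ≡⟨ ℕ.*-identityʳ b ⟨
  b ℕ.* 1                          <⟨ ℕ.*-monoʳ-< b {{ℕ.>-nonZero 0<b}} (ℕ.s<s ℕ.z<s) ⟩
  b ℕ.* suc (suc t)                ≤⟨ ℕ.m≤n+m _ (a ℕ.* s) ⟩
  a ℕ.* s ℕ.+ b ℕ.* suc (suc t)    ∎)
  where open ℕ.≤-Reasoning

-- The image of the first basis vector lies wholly in the twisted part, since `F` does not take the
-- value `suc a′`. The image of the second is orthogonal to it, so its twisted part contributes norm
-- 0 and `F` would have to take the value `suc b′`.
twisted-⟂-avoiding-∤ : ∀ {a′ b′ k} {F : Form k} (0<a : 0 < suc a′) (0<b : 0 < suc b′) →
  1 ≤ a′ → a′ < b′ → suc a′ ∤ suc b′ →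
  IsPositiveDefiniteForm (ℤ^ k) F → Avoids (suc a′) (suc b′) F →
  (pd : IsPositiveDefiniteForm (ℤ^ (2 ℕ.+ k)) (twistedForm a′ b′ ⟂ F)) →
  ¬ (formLattice pd represents ⟨ suc a′ , suc b′ ⟩ 0<a 0<b)
twisted-⟂-avoiding-∤ {a′} {b′} {k} {F} 0<a 0<b 1≤a′ a′<b′ a∤b F-pd avoids pd representation
  with s , t , Fz≡ , ¬10 , _ ← avoids (drop 2 (_represents_.σ representation (1ℤ ∷ 0ℤ ∷ [])))
     | s′ , t′ , Fz′≡ , _ , ¬01 ← avoids (drop 2 (_represents_.σ representation (0ℤ ∷ 1ℤ ∷ [])))
  = combination≢b 0<a 0<b a∤b s′ t′ ¬01
      (orthogonal-twisted a′ b′ 1≤a′ a′<b′ u v f′ u₀≢0 u₁≡0 uv≡0 norm-b)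
  where
  open _represents_ representation
  a b f f′ : ℕ
  a = suc a′
  b = suc b′
  -- `f` and `f′` are the norms of the `F`-components `z` and `z′`, as natural numbers.
  f = a ℕ.* s ℕ.+ b ℕ.* t
  f′ = a ℕ.* s′ ℕ.+ b ℕ.* t′
  e₁ e₂ u v : Vector ℤ 2
  e₁ = 1ℤ ∷ 0ℤ ∷ []
  e₂ = 0ℤ ∷ 1ℤ ∷ []
  u = take 2 (σ e₁)
  v = take 2 (σ e₂)
  z z′ : Vector ℤ k
  z = drop 2 (σ e₁)
  z′ = drop 2 (σ e₂)

  e₁-norm : ∀ A B → A * (1ℤ * 1ℤ) + (B * (0ℤ * 0ℤ) + 0ℤ) ≡ A
  e₁-norm = solve-∀
  e₂-norm : ∀ A B → A * (0ℤ * 0ℤ) + (B * (1ℤ * 1ℤ) + 0ℤ) ≡ B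
  e₂-norm = solve-∀
  e₁e₂-product : ∀ A B → A * (1ℤ * 0ℤ) + (B * (0ℤ * 1ℤ) + 0ℤ) ≡ 0ℤ
  e₁e₂-product = solve-∀

  norm-a : twistedForm a′ b′ u u + + f ≡ + a
  norm-a = trans (cong (_+_ (twistedForm a′ b′ u u)) (sym Fz≡)) (trans (isometry e₁ e₁) (e₁-norm (+ a) (+ b)))
  norm-b : twistedForm a′ b′ v v + + f′ ≡ + b
  norm-b = trans (cong (_+_ (twistedForm a′ b′ v v)) (sym Fz′≡)) (trans (isometry e₂ e₂) (e₂-norm (+ a) (+ b)))

  e₁-image : u 𝟎 ≢ 0ℤ × u 𝟏 ≡ 0ℤ × f ≡ 0
  e₁-image = shortest-twisted a′ b′ 1≤a′ a′<b′ u f norm-a (combination≢a 0<a (ℕ.s<s a′<b′) s t ¬10)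
  u₀≢0 = proj₁ e₁-image
  u₁≡0 = proj₁ (proj₂ e₁-image)

  z≗0 : z ≗ λ _ → 0ℤ
  z≗0 = PositiveDefiniteℤ^.anisotropic F-pd z (trans Fz≡ (cong +_ (proj₂ (proj₂ e₁-image))))

  zz′≡0 : F z z′ ≡ 0ℤ
  zz′≡0 = trans (IsPositiveDefiniteForm.B-cong F-pd z≗0 (λ _ → refl)) (PositiveDefinite.B-0ᴹˡ F-pd z′)

  -- Since `z` vanishes, orthogonality of the two images passes to their twisted parts.
  uv≡0 : twistedForm a′ b′ u v ≡ 0ℤ
  uv≡0 = begin
    twistedForm a′ b′ u v            ≡⟨ ℤ.+-identityʳ _ ⟨
    twistedForm a′ b′ u v + 0ℤ       ≡⟨ cong (_+_ (twistedForm a′ b′ u v)) zz′≡0 ⟨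
    twistedForm a′ b′ u v + F z z′   ≡⟨ isometry e₁ e₂ ⟩
    _                                ≡⟨ e₁e₂-product (+ a) (+ b) ⟩
    0ℤ                               ∎
    where open ≡-Reasoning

proposition4p1 : (a b : ℕ) (0<a : 0 < a) (0<b : 0 < b) →
    2 ≤ a → a < b → a ∤ b → ¬ Recoverable (⟨ a , b ⟩ 0<a 0<b)
proposition4p1 (suc a′) (suc b′) 0<a 0<b (ℕ.s≤s 1≤a′) (ℕ.s≤s a′<b′) a∤b (t , P , proper , recovers) =
  twisted-⟂-avoiding-∤ 0<a 0<b 1≤a′ a′<b′ a∤b F-pd (blocksForm-avoids a b K) pd
    (recovers (formLattice pd) represents-P)
  where
  a b : ℕ
  a = suc a′
  b = suc b′
  splits : ∀ i → ∃ (SplitsInto a′ b′ 0<a 0<b (P i))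
  splits i = proper⇒splits a′ b′ 0<a 0<b (P i) (proper i)
  K : Vector Block t
  K i = proj₁ (splits i)
  F-pd : IsPositiveDefiniteForm (ℤ^ (t ℕ.* 2)) (blocksForm a b K)
  F-pd = blocksForm-isPositiveDefinite a b 0<a 0<b K
  N-pd : IsPositiveDefiniteForm (ℤ^ 2) (twistedForm a′ b′)
  N-pd = twistedForm-isPositiveDefinite a′ b′ 1≤a′ (ℕ.≤-trans ℕ.z<s a′<b′)
  pd : IsPositiveDefiniteForm (ℤ^ (2 ℕ.+ t ℕ.* 2)) (twistedForm a′ b′ ⟂ blocksForm a b K)
  pd = ⟂-isPositiveDefinite N-pd F-pd
  represents-P : ∀ i → formLattice pd represents Sublattice.lattice (P i)
  -- Each sublattice uses the shared twisted summand and its own block, with zero in all other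
  -- blocks.
  represents-P i = isometry⇒represents pd (Sublattice.lattice (P i)) (λ x → σ x ++ κ′ x)
    (λ x y → trans (⟂-++ N-pd F-pd (σ x) (κ′ x) (σ y) (κ′ y))
      (trans (cong (_+_ (twistedForm a′ b′ (σ x) (σ y))) (inBlock-isometry a b 0<a 0<b K i (κ x) (κ y)))
             (proj₂ (proj₂ (proj₂ (splits i))) x y)))
    where
    σ κ : ℤ-Lattice.Carrierᴹ (Sublattice.lattice (P i)) → Vector ℤ 2
    σ = proj₁ (proj₂ (splits i))
    κ = proj₁ (proj₂ (proj₂ (splits i)))
    κ′ : ℤ-Lattice.Carrierᴹ (Sublattice.lattice (P i)) → Vector ℤ (t ℕ.* 2)
    κ′ x = inBlock a b 0<a 0<b i (κ x)
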